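{- The following filling-shape-Wilf-equivalences of consecutive patterns hold: $$13452\equiv_{\mathrm{fs}}13542\equiv_{\mathrm{fs}}14352\equiv_{\mathrm{fs}}14532\equiv_{\mathrm{fs}}15342\equiv_{\mathrm{fs}}15432,$$ $$12453\equiv_{\mathrm{fs}}12543,\qquad 24153\equiv_{\mathrm{fs}}25143.$$
   Context: Two sequences of positive integers of the same length are order-isomorphic, $a_1\cdots a_k\sim b_1\cdots b_k$, if for all $p,q$ one has $a_p<a_q$ iff $b_p<b_q$. A consecutive pattern is a permutation $\sigma_1\cdots\sigma_k$ of $\{1,\dots,k\}$, whose occurrences are required to be in adjacent positions, as follows. Young diagrams are drawn in French notation: a Young diagram $D$ with $n$ columns and $m$ rows is a set of cells (column, row) in $\{1,\dots,n\}\times\{1,\dots,m\}$ such that if $(a,b)\in D$ then $(a',b')\in D$ for all $1\le a'\le a$, $1\le b'\le b$; the cell $(1,1)$ is at the bottom left. A filling of $D$ is a set of selected cells of $D$ with no two in the same column and no two in the same row. For a column $c$ containing a selected cell, let $\pi(c)$ be the row of that cell. A filling contains the consecutive pattern $\sigma_1\cdots\sigma_k$ if there are consecutive columns $i_1<\cdots<i_k$ (that is, $i_{p+1}-i_p=1$ for $1\le p\le k-1$) such that $(i_1,\pi(i_1)),\dots,(i_k,\pi(i_k))$ are selected cells, $\pi(i_1)\cdots\pi(i_k)\sim\sigma_1\cdots\sigma_k$, and $(i_p,\pi(i_q))\in D$ for all $1\le p,q\le k$. Otherwise it avoids the pattern. Two patterns $\sigma,\tau$ are filling-shape-Wilf-equivalent,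 $\sigma\equiv_{\mathrm{fs}}\tau$, if for every Young diagram $D$, every set $R$ of rows and every set $C$ of columns, the number of fillings of $D$ avoiding $\sigma$ whose set of rows without a selected cell is exactly $R$ and whose set of columns without a selected cell is exactly $C$ equals the number of such fillings avoiding $\tau$. -}

module Defs where

open import Data.Bool using (true; false)
open import Data.Fin as Fin using (Fin; toℕ)
import Data.Fin.Properties as Fin
open import Data.Fin.Subset using (Subset; _∈_)
open import Data.Fin.Subset.Properties using (_∈?_)
open import Data.List.Base
  using (List; []; _∷_; length; filter; cartesianProductWith; applyUpTo)
import Data.List.Membership.Propositional as List∈
open import Data.List.Membership.Propositional.Properties
  using (∈-cartesianProductWith⁺)
open import Data.List.Relation.Binary.Permutation.Propositional using (_↭_; ↭-sym)
import Data.List.Relation.Unary.All as All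
import Data.List.Relation.Unary.AllPairs as AllPairs
open import Data.List.Relation.Unary.Any using (here; there)
open import Data.List.Relation.Unary.Unique.Propositional using (Unique)
open import Data.List.Relation.Unary.Unique.Propositional.Properties
  using (cartesianProductWith⁺)
open import Data.List.Sort.Base using (SortingAlgorithm)
import Data.List.Sort.MergeSort as MergeSort
open import Data.Nat using (ℕ; zero; suc; _<_; _<?_)
import Data.Nat.Properties as ℕ
open import Data.Product using (_×_; _,_; ∃; ∃-syntax)
open import Data.Vec as Vec using (Vec; []; _∷_; lookup; toList)
open import Data.Vec.Properties using (∷-injective)
open import Function.Bundles using (_⇔_; mk⇔; Equivalence)
open import Relation.Binary.PropositionalEquality using (_≡_; refl; subst)
open import Relation.Nullary
  using (¬_; ¬?; Dec; _×-dec_; _→-dec_)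
open import Relation.Nullary.Decidable using (map′)
open import Relation.Unary using (Decidable)

private
  variable
    n m k l : ℕ

infix 4 _∼_

_∼_ : Vec ℕ k → Vec ℕ k → Set
_∼_ {k} a b = ∀ (p q : Fin k) →
  lookup a p < lookup a q ⇔ lookup b p < lookup b q

record Pattern (k : ℕ) : Set where
  constructor mkPattern
  field
    word          : Vec ℕ k
    isPermutation : toList word ↭ applyUpTo suc k

-- Columns and rows are numbered from 0, so that the bottom left cell is
-- (0 , 0).  A set of cells is the vector of its columns, each of which is
-- the set of the rows it meets; columns of a diagram may be empty.

Cells : ℕ → ℕ → Set
Cells n m = Vec (Subset m) n

infix 4 ⟨_,_⟩∈_

⟨_,_⟩∈_ : Fin n → Fin m → Cells n m → Set
⟨ a , b ⟩∈ S = b ∈ lookup S a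

record YoungDiagram (n m : ℕ) : Set where
  field
    cells      : Cells n m
    downClosed : ∀ {a a′ b b′} → a′ Fin.≤ a → b′ Fin.≤ b →
                 ⟨ a , b ⟩∈ cells → ⟨ a′ , b′ ⟩∈ cells

open YoungDiagram public using (cells)

IsFilling : YoungDiagram n m → Cells n m → Set
IsFilling D S =
  (∀ a b → ⟨ a , b ⟩∈ S → ⟨ a , b ⟩∈ cells D) ×
  (∀ a b b′ → ⟨ a , b ⟩∈ S → ⟨ a , b′ ⟩∈ S → b ≡ b′) ×
  (∀ a a′ b → ⟨ a , b ⟩∈ S → ⟨ a′ , b ⟩∈ S → a ≡ a′)

Consecutive : Vec (Fin n) k → Set
Consecutive {k = k} i = ∀ (p q : Fin k) →
  toℕ q ≡ suc (toℕ p) → toℕ (lookup i q) ≡ suc (toℕ (lookup i p))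

-- i lists the columns of the occurrence and r the rows π(i₁), …, π(i_k).
-- Numbering rows from 0 rather than 1 does not affect order-isomorphism.

Occurrence : YoungDiagram n m → Cells n m → Pattern k →
             Vec (Fin n) k → Vec (Fin m) k → Set
Occurrence D S σ i r =
  Consecutive i ×
  (∀ p → ⟨ lookup i p , lookup r p ⟩∈ S) ×
  (Vec.map toℕ r ∼ Pattern.word σ) ×
  (∀ p q → ⟨ lookup i p , lookup r q ⟩∈ cells D)

Contains : YoungDiagram n m → Cells n m → Pattern k → Set
Contains D S σ = ∃[ i ] ∃[ r ] Occurrence D S σ i r

Avoids : YoungDiagram n m → Cells n m → Pattern k → Set
Avoids D S σ = ¬ Contains D S σ

EmptyRowsAre : Cells n m → Subset m → Set
EmptyRowsAre S R = ∀ b → b ∈ R ⇔ (∀ a → ¬ ⟨ a , b ⟩∈ S)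

EmptyColumnsAre : Cells n m → Subset n → Set
EmptyColumnsAre S C = ∀ a → a ∈ C ⇔ (∀ b → ¬ ⟨ a , b ⟩∈ S)

IsAvoidingFilling : YoungDiagram n m → Pattern k → Subset m → Subset n →
                    Cells n m → Set
IsAvoidingFilling D σ R C S =
  IsFilling D S × Avoids D S σ × EmptyRowsAre S R × EmptyColumnsAre S C

_⇔-dec_ : {A B : Set} → Dec A → Dec B → Dec (A ⇔ B)
a? ⇔-dec b? = map′ (λ (f , g) → mk⇔ f g)
                   (λ e → Equivalence.to e , Equivalence.from e)
                   ((a? →-dec b?) ×-dec (b? →-dec a?))

⟨_,_⟩∈?_ : ∀ (a : Fin n) (b : Fin m) S → Dec (⟨ a , b ⟩∈ S)
⟨ a , b ⟩∈? S = b ∈? lookup S a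

anyVec? : {P : Vec (Fin n) k → Set} → Decidable P → Dec (∃ P)
anyVec? {k = zero}  P? = map′ (λ p → [] , p) (λ { ([] , p) → p }) (P? [])
anyVec? {k = suc k} P? =
  map′ (λ { (x , v , p) → x ∷ v , p }) (λ { (x ∷ v , p) → x , v , p })
       (Fin.any? λ x → anyVec? λ v → P? (x ∷ v))

isFilling? : (D : YoungDiagram n m) → Decidable (IsFilling D)
isFilling? D S =
  (Fin.all? λ a → Fin.all? λ b →
    (⟨ a , b ⟩∈? S) →-dec (⟨ a , b ⟩∈? cells D)) ×-dec
  (Fin.all? λ a → Fin.all? λ b → Fin.all? λ b′ →
    (⟨ a , b ⟩∈? S) →-dec ((⟨ a , b′ ⟩∈? S) →-dec (b Fin.≟ b′))) ×-dec
  (Fin.all? λ a → Fin.all? λ a′ → Fin.all? λ b →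
    (⟨ a , b ⟩∈? S) →-dec ((⟨ a′ , b ⟩∈? S) →-dec (a Fin.≟ a′)))

_∼?_ : (a b : Vec ℕ k) → Dec (a ∼ b)
a ∼? b = Fin.all? λ p → Fin.all? λ q →
  (lookup a p <? lookup a q) ⇔-dec (lookup b p <? lookup b q)

occurrence? : (D : YoungDiagram n m) (S : Cells n m) (σ : Pattern k) →
              ∀ i r → Dec (Occurrence D S σ i r)
occurrence? D S σ i r =
  (Fin.all? λ p → Fin.all? λ q →
    (toℕ q ℕ.≟ suc (toℕ p)) →-dec
    (toℕ (lookup i q) ℕ.≟ suc (toℕ (lookup i p)))) ×-dec
  (Fin.all? λ p → ⟨ lookup i p , lookup r p ⟩∈? S) ×-dec
  (Vec.map toℕ r ∼? Pattern.word σ) ×-dec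
  (Fin.all? λ p → Fin.all? λ q → ⟨ lookup i p , lookup r q ⟩∈? cells D)

contains? : (D : YoungDiagram n m) (S : Cells n m) (σ : Pattern k) →
            Dec (Contains D S σ)
contains? D S σ = anyVec? λ i → anyVec? λ r → occurrence? D S σ i r

isAvoidingFilling? : ∀ (D : YoungDiagram n m) (σ : Pattern k) R C →
                     Decidable (IsAvoidingFilling D σ R C)
isAvoidingFilling? D σ R C S =
  isFilling? D S ×-dec
  ¬? (contains? D S σ) ×-dec
  (Fin.all? λ b → (b ∈? R) ⇔-dec (Fin.all? λ a → ¬? (⟨ a , b ⟩∈? S))) ×-dec
  (Fin.all? λ a → (a ∈? C) ⇔-dec (Fin.all? λ b → ¬? (⟨ a , b ⟩∈? S)))

allVecs : {A : Set} → List A → ∀ n → List (Vec A n)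
allVecs xs zero    = [] ∷ []
allVecs xs (suc n) = cartesianProductWith _∷_ xs (allVecs xs n)

allSubsets : ∀ n → List (Subset n)
allSubsets = allVecs (true ∷ false ∷ [])

allCells : ∀ n m → List (Cells n m)
allCells n m = allVecs (allSubsets m) n

-- Every set of cells occurs in allCells exactly once, so that filtering it
-- and taking the length counts sets of cells.

allVecs-complete : {A : Set} {xs : List A} → (∀ x → x List∈.∈ xs) →
                   (v : Vec A n) → v List∈.∈ allVecs xs n
allVecs-complete all []      = here refl
allVecs-complete all (x ∷ v) =
  ∈-cartesianProductWith⁺ _∷_ (all x) (allVecs-complete all v)

allVecs-unique : {A : Set} {xs : List A} → Unique xs →
                 ∀ n → Unique (allVecs xs n)
allVecs-unique u zero    = All.[] AllPairs.∷ AllPairs.[]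
allVecs-unique u (suc n) =
  cartesianProductWith⁺ _∷_ ∷-injective u (allVecs-unique u n)

allCells-complete : (S : Cells n m) → S List∈.∈ allCells n m
allCells-complete = allVecs-complete (allVecs-complete
  λ { true → here refl ; false → there (here refl) })

allCells-unique : ∀ n m → Unique (allCells n m)
allCells-unique n m = allVecs-unique (allVecs-unique
  (((λ ()) All.∷ All.[]) AllPairs.∷ All.[] AllPairs.∷ AllPairs.[]) m) n

numberAvoiding : YoungDiagram n m → Pattern k → Subset m → Subset n → ℕ
numberAvoiding {n} {m} D σ R C =
  length (filter (isAvoidingFilling? D σ R C) (allCells n m))

infix 4 _≡fs_

_≡fs_ : Pattern k → Pattern l → Set
σ ≡fs τ = ∀ {n m} (D : YoungDiagram n m) (R : Subset m) (C : Subset n) →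
  numberAvoiding D σ R C ≡ numberAvoiding D τ R C

open SortingAlgorithm (MergeSort.mergeSort ℕ.≤-decTotalOrder) using (sort; sort-↭)

fromWord : (w : Vec ℕ k) → sort (toList w) ≡ applyUpTo suc k → Pattern k
fromWord w eq = mkPattern w (subst (toList w ↭_) eq (↭-sym (sort-↭ (toList w))))

σ13452 σ13542 σ14352 σ14532 σ15342 σ15432 : Pattern 5
σ13452 = fromWord (1 ∷ 3 ∷ 4 ∷ 5 ∷ 2 ∷ []) refl
σ13542 = fromWord (1 ∷ 3 ∷ 5 ∷ 4 ∷ 2 ∷ []) refl
σ14352 = fromWord (1 ∷ 4 ∷ 3 ∷ 5 ∷ 2 ∷ []) refl
σ14532 = fromWord (1 ∷ 4 ∷ 5 ∷ 3 ∷ 2 ∷ []) refl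
σ15342 = fromWord (1 ∷ 5 ∷ 3 ∷ 4 ∷ 2 ∷ []) refl
σ15432 = fromWord (1 ∷ 5 ∷ 4 ∷ 3 ∷ 2 ∷ []) refl

σ12453 σ12543 σ24153 σ25143 : Pattern 5
σ12453 = fromWord (1 ∷ 2 ∷ 4 ∷ 5 ∷ 3 ∷ []) refl
σ12543 = fromWord (1 ∷ 2 ∷ 5 ∷ 4 ∷ 3 ∷ []) refl
σ24153 = fromWord (2 ∷ 4 ∷ 1 ∷ 5 ∷ 3 ∷ []) refl
σ25143 = fromWord (2 ∷ 5 ∷ 1 ∷ 4 ∷ 3 ∷ []) refl

{-# OPTIONS --safe #-}

-- All the equivalences are composed of steps σ ≡fs τ in which τ arises from σ
-- by an involution ρ of the positions.  For these σ and τ, an occurrence of one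
-- that overlaps another occurrence of either in a position moved by ρ
-- coincides with it.  Permuting by ρ the columns of every occurrence of σ or τ
-- is therefore a well-defined operation on fillings, which preserves the set of
-- these occurrences but interchanges their kinds.  So it is an involution, and
-- it takes the fillings avoiding σ to those avoiding τ.

module Submission where

open import Defs
open import Data.Bool using (Bool; true; false; not; if_then_else_)
open import Data.Bool.Properties using (not-involutive)
open import Data.Fin as Fin using (Fin; zero; suc; toℕ; #_)
import Data.Fin.Properties as Fin
open import Data.Fin.Permutation.Components using (transpose)
import Data.Fin.Subset as Subset
open import Data.List.Base as List using (List; []; _∷_; length; filter; _++_)
open import Data.List.Membership.Propositional using (_∈_)
open import Data.List.Membership.Propositional.Properties
  using (∈-∃++; ∈-++⁻; ∈-++⁺ˡ; ∈-++⁺ʳ; ∈-filter⁺; ∈-filter⁻; ∈-map⁺)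
open import Data.List.Properties using (length-++; length-map)
open import Data.List.Relation.Binary.Subset.Propositional using (_⊆_)
import Data.List.Relation.Unary.All as All
open import Data.List.Relation.Unary.AllPairs using ([]; _∷_)
open import Data.List.Relation.Unary.Any using (here; there)
open import Data.List.Relation.Unary.Unique.Propositional using (Unique)
open import Data.List.Relation.Unary.Unique.Propositional.Properties using (filter⁺)
open import Data.Nat using (ℕ; zero; suc; _+_; _≤_; _<_; z≤n; s≤s; _<?_)
import Data.Nat.Properties as ℕ
open import Data.Product using (_×_; _,_; ∃; ∃-syntax; proj₁; proj₂)
open import Data.Sum using (_⊎_; inj₁; inj₂; [_,_]′)
open import Data.Vec as Vec using (Vec; []; _∷_; lookup; tabulate)
open import Data.Vec.Properties
  using (lookup∘tabulate; tabulate∘lookup; tabulate-cong; lookup-map)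
open import Function.Base using (_∘_)
open import Function.Bundles using (_⇔_; mk⇔; Equivalence)
open import Function.Construct.Composition using (_⇔-∘_)
open import Relation.Binary.PropositionalEquality
  using (_≡_; _≢_; refl; sym; trans; cong; cong₂; subst; subst₂; module ≡-Reasoning)
open import Relation.Nullary using (¬_; Dec; yes; no; contradiction; ¬?; _×-dec_; _⊎-dec_; _→-dec_)
open import Relation.Nullary.Decidable using (map′; decidable-stable; from-yes)
open import Relation.Unary using (Decidable)

private
  variable
    n m k : ℕ
    A : Set

-- Comparing the lengths of filtered lists

⊆⇒length-≤ : {xs ys : List A} → Unique xs → xs ⊆ ys → length xs ≤ length ys
⊆⇒length-≤ {xs = []} _ _ = z≤n
⊆⇒length-≤ {xs = x ∷ xs} (x∉xs ∷ uniq) xs⊆ys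
  with ps , qs , refl ← ∈-∃++ (xs⊆ys (here refl)) = begin
    suc (length xs)              ≤⟨ s≤s (⊆⇒length-≤ uniq xs⊆ps++qs) ⟩
    suc (length (ps ++ qs))      ≡⟨ cong suc (length-++ ps) ⟩
    suc (length ps + length qs)  ≡⟨ ℕ.+-suc (length ps) (length qs) ⟨
    length ps + suc (length qs)  ≡⟨ length-++ ps ⟨
    length (ps ++ x ∷ qs)        ∎
  where
  open ℕ.≤-Reasoning
  xs⊆ps++qs : xs ⊆ ps ++ qs
  xs⊆ps++qs y∈xs with ∈-++⁻ ps (xs⊆ys (there y∈xs))
  ... | inj₁ y∈ps = ∈-++⁺ˡ y∈ps
  ... | inj₂ (there y∈qs) = ∈-++⁺ʳ ps y∈qs
  ... | inj₂ (here refl) = contradiction refl (All.lookup x∉xs y∈xs)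

-- Since `x` equals `f (f x)` on `P`, each entry satisfying `P` is the image under `f` of one
-- satisfying `Q`. Being an involution on `P` alone suffices, so `f` may behave arbitrarily on cell
-- sets that are not fillings.
filter-length-≤ : {P Q : A → Set} (P? : Decidable P) (Q? : Decidable Q) {xs : List A} →
  Unique xs → (∀ x → x ∈ xs) → (f : A → A) → (∀ {x} → P x → Q (f x) × f (f x) ≡ x) →
  length (filter P? xs) ≤ length (filter Q? xs)
filter-length-≤ P? Q? {xs} uniq complete f P⇒Q =
  subst (length (filter P? xs) ≤_) (length-map f (filter Q? xs))
    (⊆⇒length-≤ (filter⁺ P? uniq) P⊆fQ)
  where
  P⊆fQ : filter P? xs ⊆ List.map f (filter Q? xs)
  P⊆fQ {x} x∈ with Qfx , ffx≡x ← P⇒Q (proj₂ (∈-filter⁻ P? {xs = xs} x∈)) =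
    subst (_∈ List.map f (filter Q? xs)) ffx≡x
      (∈-map⁺ f (∈-filter⁺ Q? (complete (f x)) Qfx))

lookup-ext : {v w : Vec A n} → (∀ i → lookup v i ≡ lookup w i) → v ≡ w
lookup-ext {v = v} {w} eq =
  trans (sym (tabulate∘lookup v)) (trans (tabulate-cong eq) (tabulate∘lookup w))

-- Runs of consecutive columns

consecutive-lookup : (i : Vec (Fin n) (suc k)) → Consecutive i →
  ∀ p → toℕ (lookup i p) ≡ toℕ (lookup i zero) + toℕ p
consecutive-lookup i con zero = sym (ℕ.+-identityʳ _)
consecutive-lookup (x ∷ y ∷ i) con (suc p) = begin
  toℕ (lookup (y ∷ i) p)  ≡⟨ consecutive-lookup (y ∷ i) (λ p q e → con (suc p) (suc q) (cong suc e)) p ⟩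
  toℕ y + toℕ p           ≡⟨ cong (_+ toℕ p) (con zero (suc zero) refl) ⟩
  suc (toℕ x + toℕ p)     ≡⟨ ℕ.+-suc (toℕ x) (toℕ p) ⟨
  toℕ x + suc (toℕ p)     ∎
  where open ≡-Reasoning

-- The difference between a column and its position is constant along a run; additions on both sides
-- avoid truncated subtraction.
consecutive-shift : (i : Vec (Fin n) k) → Consecutive i →
  ∀ a p → toℕ (lookup i p) + toℕ a ≡ toℕ (lookup i a) + toℕ p
consecutive-shift {k = suc _} i con a p = begin
  toℕ (lookup i p) + toℕ a           ≡⟨ cong (_+ toℕ a) (consecutive-lookup i con p) ⟩
  toℕ (lookup i zero) + toℕ p + toℕ a ≡⟨ ℕ.+-assoc _ (toℕ p) (toℕ a) ⟩
  toℕ (lookup i zero) + (toℕ p + toℕ a) ≡⟨ cong (toℕ (lookup i zero) +_) (ℕ.+-comm (toℕ p) (toℕ a)) ⟩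
  toℕ (lookup i zero) + (toℕ a + toℕ p) ≡⟨ ℕ.+-assoc _ (toℕ a) (toℕ p) ⟨
  toℕ (lookup i zero) + toℕ a + toℕ p ≡⟨ cong (_+ toℕ p) (consecutive-lookup i con a) ⟨
  toℕ (lookup i a) + toℕ p           ∎
  where open ≡-Reasoning

-- p and p′ are matched when a and b are superimposed.
Matched : (a b p p′ : Fin k) → Set
Matched a b p p′ = toℕ p + toℕ b ≡ toℕ p′ + toℕ a

-- Two runs sharing a column are translates of each other. The sum `toℕ a + toℕ b` is added to both
-- sides and cancelled at the end.
consecutive-matched : (i i′ : Vec (Fin n) k) → Consecutive i → Consecutive i′ →
  ∀ a b → lookup i a ≡ lookup i′ b →
  ∀ p p′ → Matched a b p p′ → lookup i p ≡ lookup i′ p′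
consecutive-matched i i′ con con′ a b ia≡i′b p p′ match =
  Fin.toℕ-injective (ℕ.+-cancelʳ-≡ (toℕ a + toℕ b) _ _ (begin
    toℕ (lookup i p) + (toℕ a + toℕ b)    ≡⟨ ℕ.+-assoc _ (toℕ a) (toℕ b) ⟨
    toℕ (lookup i p) + toℕ a + toℕ b      ≡⟨ cong (_+ toℕ b) (consecutive-shift i con a p) ⟩
    toℕ (lookup i a) + toℕ p + toℕ b      ≡⟨ ℕ.+-assoc _ (toℕ p) (toℕ b) ⟩
    toℕ (lookup i a) + (toℕ p + toℕ b)    ≡⟨ cong₂ _+_ (cong toℕ ia≡i′b) match ⟩
    toℕ (lookup i′ b) + (toℕ p′ + toℕ a)  ≡⟨ ℕ.+-assoc _ (toℕ p′) (toℕ a) ⟨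
    toℕ (lookup i′ b) + toℕ p′ + toℕ a    ≡⟨ cong (_+ toℕ a) (consecutive-shift i′ con′ b p′) ⟨
    toℕ (lookup i′ p′) + toℕ b + toℕ a    ≡⟨ ℕ.+-assoc _ (toℕ b) (toℕ a) ⟩
    toℕ (lookup i′ p′) + (toℕ b + toℕ a)  ≡⟨ cong (toℕ (lookup i′ p′) +_) (ℕ.+-comm (toℕ b) (toℕ a)) ⟩
    toℕ (lookup i′ p′) + (toℕ a + toℕ b)  ∎))
  where open ≡-Reasoning

-- Pairs of patterns that can be exchanged

-- A necessary condition for occurrences of `w` and `w′` to overlap with `a` above `b`: on the
-- shared columns both words must prescribe the same relative order.
OrderCompatible : (w w′ : Vec ℕ k) (a b : Fin k) → Set
OrderCompatible w w′ a b = ∀ p p′ → Matched a b p p′ → ∀ q q′ → Matched a b q q′ →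
  (lookup w p < lookup w q) ⇔ (lookup w′ p′ < lookup w′ q′)

record Exchange (pat : Bool → Pattern k) (ρ : Fin k → Fin k) : Set where
  constructor mkExchange

  word : Bool → Vec ℕ k
  word c = Pattern.word (pat c)

  field
    ρ-involutive : ∀ p → ρ (ρ p) ≡ p
    word-not     : ∀ c p → lookup (word (not c)) p ≡ lookup (word c) (ρ p)
    rigid        : ∀ c c′ a b → ρ a ≢ a → OrderCompatible (word c) (word c′) a b → a ≡ b

∀Bool? : {P : Bool → Set} → Decidable P → Dec (∀ c → P c)
∀Bool? P? = map′ (λ { (f , t) false → f ; (f , t) true → t }) (λ g → g false , g true)
                 (P? false ×-dec P? true)

∃Bool? : {P : Bool → Set} → Decidable P → Dec (∃ P)
∃Bool? P? = map′ [ (false ,_) , (true ,_) ]′ (λ { (false , p) → inj₁ p ; (true , p) → inj₂ p })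
                 (P? false ⊎-dec P? true)

-- Every condition ranges over finitely many positions and kinds, so for concrete patterns it is
-- settled by evaluation.
exchange? : (pat : Bool → Pattern k) (ρ : Fin k → Fin k) → Dec (Exchange pat ρ)
exchange? pat ρ =
  map′ (λ (inv , wn , rig) → mkExchange inv wn rig)
       (λ e → Exchange.ρ-involutive e , Exchange.word-not e , Exchange.rigid e)
  ((Fin.all? λ p → ρ (ρ p) Fin.≟ p) ×-dec
   (∀Bool? λ c → Fin.all? λ p → lookup (word (not c)) p ℕ.≟ lookup (word c) (ρ p)) ×-dec
   (∀Bool? λ c → ∀Bool? λ c′ → Fin.all? λ a → Fin.all? λ b →
     ¬? (ρ a Fin.≟ a) →-dec (compatible? (word c) (word c′) a b →-dec (a Fin.≟ b))))
  where
  word : Bool → Vec ℕ _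
  word c = Pattern.word (pat c)

  compatible? : ∀ w w′ a b → Dec (OrderCompatible w w′ a b)
  compatible? w w′ a b =
    Fin.all? λ p → Fin.all? λ p′ → (toℕ p + toℕ b ℕ.≟ toℕ p′ + toℕ a) →-dec
    (Fin.all? λ q → Fin.all? λ q′ → (toℕ q + toℕ b ℕ.≟ toℕ q′ + toℕ a) →-dec
    ((lookup w p <? lookup w q) ⇔-dec (lookup w′ p′ <? lookup w′ q′)))

-- Rearranging a set of cells along its hits

module _ {pat : Bool → Pattern k} {ρ : Fin k → Fin k} (ex : Exchange pat ρ)
         (D : YoungDiagram n m) where

  open Exchange ex

  Hit : Cells n m → Vec (Fin n) k → Set
  Hit S i = ∃[ c ] ∃[ r ] Occurrence D S (pat c) i r

  -- The new content of column `a` is to come from column `b`. Positions fixed by `ρ` are included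
  -- and give `b` equal to `a`.
  Moves : Cells n m → Fin n → Fin n → Set
  Moves S a b = ∃[ i ] Hit S i × ∃[ p ] lookup i p ≡ a × lookup i (ρ p) ≡ b

  -- Were it to unfold, normalising a type that mentions move would expand the
  -- whole search.
  abstract
    moves? : ∀ S a → Dec (∃ (Moves S a))
    moves? S a = Fin.any? λ b → anyVec? λ i →
      (∃Bool? λ c → anyVec? λ r → occurrence? D S (pat c) i r) ×-dec
      (Fin.any? λ p → (lookup i p Fin.≟ a) ×-dec (lookup i (ρ p) Fin.≟ b))

  -- Takes whichever witness the search finds; in a filling, `Moves-functional` makes the choice
  -- immaterial. A column in no hit stays where it is.
  move : Cells n m → Fin n → Fin n
  move S a with moves? S a
  ... | yes (b , _) = b
  ... | no  _       = a

  move-view : ∀ S a → Moves S a (move S a) ⊎ move S a ≡ a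
  move-view S a with moves? S a
  ... | yes (b , mv) = inj₁ mv
  ... | no  _        = inj₂ refl

  rearrange : Cells n m → Cells n m
  rearrange S = tabulate (lookup S ∘ move S)

  Moves-sym : ∀ S {a b} → Moves S a b → Moves S b a
  Moves-sym _ (i , hit , p , refl , refl) =
    i , hit , ρ p , refl , cong (lookup i) (ρ-involutive p)

  rearrange-column : ∀ S a → lookup (rearrange S) a ≡ lookup S (move S a)
  rearrange-column S a = lookup∘tabulate (lookup S ∘ move S) a

  ∈-rearrange : ∀ S {a b} → ⟨ a , b ⟩∈ rearrange S ⇔ ⟨ move S a , b ⟩∈ S
  ∈-rearrange S {a} {b} =
    mk⇔ (subst (Subset._∈_ b) (rearrange-column S a))
        (subst (Subset._∈_ b) (sym (rearrange-column S a)))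

  module _ (S : Cells n m) (filling : IsFilling D S) where

    -- A column of a filling has at most one selected cell, so the two hits agree on the rows of
    -- their shared columns. Hence their words are order-compatible there, and `rigid` applies.
    overlap⇒matched : ∀ i i′ → Hit S i → Hit S i′ → ∀ a b →
      ρ a ≢ a → lookup i a ≡ lookup i′ b → i ≡ i′ × a ≡ b
    overlap⇒matched i i′ (c , r , con , sel , iso , _) (c′ , r′ , con′ , sel′ , iso′ , _)
                    a b moved ia≡i′b = lookup-ext i≗i′ , a≡b
      where
      row-≡ : ∀ p p′ → Matched a b p p′ → lookup (Vec.map toℕ r) p ≡ lookup (Vec.map toℕ r′) p′
      row-≡ p p′ match = begin
        lookup (Vec.map toℕ r) p    ≡⟨ lookup-map p toℕ r ⟩
        toℕ (lookup r p)            ≡⟨ cong toℕ (proj₁ (proj₂ filling) _ _ _ (sel p)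
          (subst (λ x → ⟨ x , lookup r′ p′ ⟩∈ S)
                 (sym (consecutive-matched i i′ con con′ a b ia≡i′b p p′ match)) (sel′ p′))) ⟩
        toℕ (lookup r′ p′)          ≡⟨ lookup-map p′ toℕ r′ ⟨
        lookup (Vec.map toℕ r′) p′  ∎
        where open ≡-Reasoning

      compatible : OrderCompatible (word c) (word c′) a b
      compatible p p′ mp q q′ mq = mk⇔
        (Equivalence.to (iso′ p′ q′) ∘ subst₂ _<_ (row-≡ p p′ mp) (row-≡ q q′ mq)
          ∘ Equivalence.from (iso p q))
        (Equivalence.to (iso p q) ∘ subst₂ _<_ (sym (row-≡ p p′ mp)) (sym (row-≡ q q′ mq))
          ∘ Equivalence.from (iso′ p′ q′))

      a≡b : a ≡ b
      a≡b = rigid c c′ a b moved compatible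

      i≗i′ : ∀ p → lookup i p ≡ lookup i′ p
      i≗i′ p = consecutive-matched i i′ con con′ a b ia≡i′b p p (cong (λ x → toℕ p + toℕ x) (sym a≡b))

    -- If either position is moved by `ρ`, the two hits coincide by `overlap⇒matched`. If both are
    -- fixed, both targets are the shared column itself.
    Moves-functional : ∀ {a b b′} → Moves S a b → Moves S a b′ → b ≡ b′
    Moves-functional (i , hit , p , refl , refl) (i′ , hit′ , p′ , eq , refl)
      with ρ p Fin.≟ p | ρ p′ Fin.≟ p′
    ... | no moved | _ with refl , refl ← overlap⇒matched i i′ hit hit′ p p′ moved (sym eq) = refl
    ... | yes _ | no moved with refl , refl ← overlap⇒matched i′ i hit′ hit p′ p moved eq = refl
    ... | yes fix | yes fix′ = begin
      lookup i (ρ p)    ≡⟨ cong (lookup i) fix ⟩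
      lookup i p        ≡⟨ eq ⟨
      lookup i′ p′      ≡⟨ cong (lookup i′) fix′ ⟨
      lookup i′ (ρ p′)  ∎
      where open ≡-Reasoning

    Moves⇒move≡ : ∀ {a b} → Moves S a b → move S a ≡ b
    Moves⇒move≡ {a} mv with moves? S a
    ... | yes (_ , mv′) = Moves-functional mv′ mv
    ... | no ¬mv = contradiction (_ , mv) ¬mv

    move-involutive : ∀ a → move S (move S a) ≡ a
    move-involutive a with move-view S a
    ... | inj₁ mv = Moves⇒move≡ (Moves-sym S mv)
    ... | inj₂ eq = trans (cong (move S) eq) eq

    rearrange-filling : IsFilling D (rearrange S)
    rearrange-filling = inside , row-unique , column-unique
      where
      inside : ∀ a b → ⟨ a , b ⟩∈ rearrange S → ⟨ a , b ⟩∈ cells D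
      inside a b ab∈ with Equivalence.to (∈-rearrange S) ab∈ | move-view S a
      ... | ab∈S | inj₂ eq = proj₁ filling a b (subst (λ x → ⟨ x , b ⟩∈ S) eq ab∈S)
      -- The cell comes from column `lookup i (ρ p)`, so its row is `lookup r (ρ p)`; the rectangle
      -- condition of the hit keeps it inside `D`.
      ... | ab∈S | inj₁ (i , (_ , r , _ , sel , _ , rect) , p , refl , eq) =
        subst (λ x → ⟨ lookup i p , x ⟩∈ cells D)
          (proj₁ (proj₂ filling) _ _ _ (subst (λ x → ⟨ x , _ ⟩∈ S) eq (sel (ρ p))) ab∈S)
          (rect p (ρ p))

      row-unique : ∀ a b b′ → ⟨ a , b ⟩∈ rearrange S → ⟨ a , b′ ⟩∈ rearrange S → b ≡ b′
      row-unique a b b′ ab∈ ab′∈ =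
        proj₁ (proj₂ filling) (move S a) b b′
          (Equivalence.to (∈-rearrange S) ab∈) (Equivalence.to (∈-rearrange S) ab′∈)

      column-unique : ∀ a a′ b → ⟨ a , b ⟩∈ rearrange S → ⟨ a′ , b ⟩∈ rearrange S → a ≡ a′
      column-unique a a′ b ab∈ a′b∈ = begin
        a                    ≡⟨ move-involutive a ⟨
        move S (move S a)    ≡⟨ cong (move S) (proj₂ (proj₂ filling) _ _ b
          (Equivalence.to (∈-rearrange S) ab∈) (Equivalence.to (∈-rearrange S) a′b∈)) ⟩
        move S (move S a′)   ≡⟨ move-involutive a′ ⟩
        a′                   ∎
        where open ≡-Reasoning

    rearrange-emptyRow : ∀ b → (∀ a → ¬ ⟨ a , b ⟩∈ S) ⇔ (∀ a → ¬ ⟨ a , b ⟩∈ rearrange S)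
    rearrange-emptyRow b = mk⇔
      (λ empty a → empty (move S a) ∘ Equivalence.to (∈-rearrange S))
      (λ empty a ab∈S → empty (move S a) (Equivalence.from (∈-rearrange S)
        (subst (λ x → ⟨ x , b ⟩∈ S) (sym (move-involutive a)) ab∈S)))

    rearrange-emptyColumn : ∀ a → (∀ b → ¬ ⟨ a , b ⟩∈ S) ⇔ (∀ b → ¬ ⟨ a , b ⟩∈ rearrange S)
    rearrange-emptyColumn a with move-view S a
    ... | inj₂ eq = mk⇔
      (λ empty b → empty b ∘ subst (λ x → ⟨ x , b ⟩∈ S) eq ∘ Equivalence.to (∈-rearrange S))
      (λ empty b → empty b ∘ Equivalence.from (∈-rearrange S) ∘ subst (λ x → ⟨ x , b ⟩∈ S) (sym eq))
    -- A column of a hit holds a selected cell both before and after, so either emptiness hypothesis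
    -- is absurd.
    ... | inj₁ (i , (_ , r , _ , sel , _) , p , eq , eq′) = mk⇔
      (λ empty → contradiction (subst (λ x → ⟨ x , _ ⟩∈ S) eq (sel p)) (empty _))
      (λ empty → contradiction
        (Equivalence.from (∈-rearrange S) (subst (λ x → ⟨ x , _ ⟩∈ S) eq′ (sel (ρ p)))) (empty _))

    -- Position `p` receives the row of position `ρ p`, and `word-not` says that this permutes the
    -- word of one kind into the other. The columns and the set of rows are unchanged, so the
    -- rectangle condition persists.
    rearrange-occurrence : ∀ c i r → Occurrence D S (pat c) i r →
      Occurrence D (rearrange S) (pat (not c)) i (tabulate (lookup r ∘ ρ))
    rearrange-occurrence c i r occ@(con , sel , iso , rect) = con , sel′ , iso′ , rect′
      where
      r′ : Vec (Fin m) k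
      r′ = tabulate (lookup r ∘ ρ)

      r′-lookup : ∀ p → lookup r′ p ≡ lookup r (ρ p)
      r′-lookup = lookup∘tabulate (lookup r ∘ ρ)

      sel′ : ∀ p → ⟨ lookup i p , lookup r′ p ⟩∈ rearrange S
      sel′ p = Equivalence.from (∈-rearrange S)
        (subst₂ (λ x y → ⟨ x , y ⟩∈ S)
          (sym (Moves⇒move≡ (i , (c , r , occ) , p , refl , refl)))
          (sym (r′-lookup p)) (sel (ρ p)))

      rows-lookup : ∀ p → lookup (Vec.map toℕ r) (ρ p) ≡ lookup (Vec.map toℕ r′) p
      rows-lookup p = begin
        lookup (Vec.map toℕ r) (ρ p)  ≡⟨ lookup-map (ρ p) toℕ r ⟩
        toℕ (lookup r (ρ p))          ≡⟨ cong toℕ (r′-lookup p) ⟨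
        toℕ (lookup r′ p)             ≡⟨ lookup-map p toℕ r′ ⟨
        lookup (Vec.map toℕ r′) p     ∎
        where open ≡-Reasoning

      iso′ : Vec.map toℕ r′ ∼ word (not c)
      iso′ p q = subst₂ _⇔_
        (cong₂ _<_ (rows-lookup p) (rows-lookup q))
        (sym (cong₂ _<_ (word-not c p) (word-not c q)))
        (iso (ρ p) (ρ q))

      rect′ : ∀ p q → ⟨ lookup i p , lookup r′ q ⟩∈ cells D
      rect′ p q = subst (λ y → ⟨ lookup i p , y ⟩∈ cells D) (sym (r′-lookup q)) (rect p (ρ q))

    rearrange-hit : ∀ i → Hit S i → Hit (rearrange S) i
    rearrange-hit i (c , r , occ) = not c , tabulate (lookup r ∘ ρ) , rearrange-occurrence c i r occ

  -- Rearranging twice, and equality of the counts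

  module _ (S : Cells n m) (filling : IsFilling D S) where

    -- A hit of the rearrangement is either made of columns that did not move,
    -- or it overlaps a moved column and hence is the hit which moved it.
    rearrange-hit⁻ : ∀ i → Hit (rearrange S) i → Hit S i
    rearrange-hit⁻ i hit@(c , r , con , sel , iso , rect)
      with Fin.any? (λ p → ¬? (move S (lookup i p) Fin.≟ lookup i p))
    ... | no unmoved = c , r , con , sel′ , iso , rect
      where
      sel′ : ∀ p → ⟨ lookup i p , lookup r p ⟩∈ S
      sel′ p = subst (λ x → ⟨ x , lookup r p ⟩∈ S)
        (decidable-stable (_ Fin.≟ _) (λ moved → unmoved (p , moved)))
        (Equivalence.to (∈-rearrange S) (sel p))
    ... | yes (p , moved) with move-view S (lookup i p)
    ...   | inj₂ eq = contradiction eq moved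
    ...   | inj₁ (i′ , hit′ , p′ , eq , eq′) = subst (Hit S) i′≡i hit′
      where
      ρ-moves : ρ p′ ≢ p′
      ρ-moves fix = moved (trans (sym eq′) (trans (cong (lookup i′) fix) eq))

      i′≡i : i′ ≡ i
      i′≡i = proj₁ (overlap⇒matched (rearrange S) (rearrange-filling S filling) i′ i
                     (rearrange-hit S filling i′ hit′) hit p′ p ρ-moves eq)

    -- `S` and its rearrangement have the same hits, and these alone determine `move`.
    move-rearrange : ∀ a → move (rearrange S) a ≡ move S a
    move-rearrange a with move-view S a | move-view (rearrange S) a
    ... | inj₁ (i , hit , at) | _ =
      Moves⇒move≡ (rearrange S) (rearrange-filling S filling) (i , rearrange-hit S filling i hit , at)
    ... | inj₂ _ | inj₁ (i , hit , at) =
      sym (Moves⇒move≡ S filling (i , rearrange-hit⁻ i hit , at))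
    ... | inj₂ eq | inj₂ eq′ = trans eq′ (sym eq)

    rearrange-involutive : rearrange (rearrange S) ≡ S
    rearrange-involutive = lookup-ext λ a → begin
      lookup (rearrange (rearrange S)) a        ≡⟨ rearrange-column (rearrange S) a ⟩
      lookup (rearrange S) (move (rearrange S) a) ≡⟨ rearrange-column S _ ⟩
      lookup S (move S (move (rearrange S) a))  ≡⟨ cong (lookup S ∘ move S) (move-rearrange a) ⟩
      lookup S (move S (move S a))              ≡⟨ cong (lookup S) (move-involutive S filling a) ⟩
      lookup S a                                ∎
      where open ≡-Reasoning

    -- An occurrence of the other kind in the rearrangement would, on rearranging back, become an
    -- occurrence of kind `c` in `S`.
    rearrange-avoids : ∀ {c} → Avoids D S (pat c) → Avoids D (rearrange S) (pat (not c))
    rearrange-avoids {c} avoids (i , r , occ) = avoids (i , tabulate (lookup r ∘ ρ) ,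
      subst₂ (λ T d → Occurrence D T (pat d) i (tabulate (lookup r ∘ ρ)))
        rearrange-involutive (not-involutive c)
        (rearrange-occurrence (rearrange S) (rearrange-filling S filling) (not c) i r occ))

  rearrange-avoidingFilling : ∀ c R C S → IsAvoidingFilling D (pat c) R C S →
    IsAvoidingFilling D (pat (not c)) R C (rearrange S)
  rearrange-avoidingFilling c R C S (filling , avoids , rows , columns) =
    rearrange-filling S filling ,
    rearrange-avoids S filling avoids ,
    (λ b → rearrange-emptyRow S filling b ⇔-∘ rows b) ,
    (λ a → rearrange-emptyColumn S filling a ⇔-∘ columns a)

  -- The equations let `σ` and `τ` be named directly; the two values of `c` yield the two opposite
  -- inequalities.
  numberAvoiding-≤ : ∀ R C c {σ τ} → pat c ≡ σ → pat (not c) ≡ τ →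
    numberAvoiding D σ R C ≤ numberAvoiding D τ R C
  numberAvoiding-≤ R C c {σ} {τ} refl refl = filter-length-≤
    (isAvoidingFilling? D σ R C) (isAvoidingFilling? D τ R C)
    (allCells-unique n m) allCells-complete rearrange
    (λ {S} p → rearrange-avoidingFilling c R C S p , rearrange-involutive S (proj₁ p))

choose : Pattern k → Pattern k → Bool → Pattern k
choose σ τ c = if c then σ else τ

exchange⇒≡fs : (σ τ : Pattern k) {ρ : Fin k → Fin k} → Exchange (choose σ τ) ρ → σ ≡fs τ
exchange⇒≡fs σ τ ex D R C = ℕ.≤-antisym
  (numberAvoiding-≤ ex D R C true {σ} {τ} refl refl)
  (numberAvoiding-≤ ex D R C false {τ} {σ} refl refl)

≡fs-sym : (σ τ : Pattern k) → σ ≡fs τ → τ ≡fs σ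
≡fs-sym σ τ στ D R C = sym (στ D R C)

≡fs-trans : (σ τ υ : Pattern k) → σ ≡fs τ → τ ≡fs υ → σ ≡fs υ
≡fs-trans σ τ υ στ τυ D R C = trans (στ D R C) (τυ D R C)

-- The transposition steps for the concrete patterns, positions counted from 0

13452≡13542 : σ13452 ≡fs σ13542
13452≡13542 = exchange⇒≡fs σ13452 σ13542
  (from-yes (exchange? (choose σ13452 σ13542) (transpose (# 2) (# 3))))

13452≡14352 : σ13452 ≡fs σ14352
13452≡14352 = exchange⇒≡fs σ13452 σ14352
  (from-yes (exchange? (choose σ13452 σ14352) (transpose (# 1) (# 2))))

14352≡15342 : σ14352 ≡fs σ15342
14352≡15342 = exchange⇒≡fs σ14352 σ15342
  (from-yes (exchange? (choose σ14352 σ15342) (transpose (# 1) (# 3))))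

14532≡15432 : σ14532 ≡fs σ15432
14532≡15432 = exchange⇒≡fs σ14532 σ15432
  (from-yes (exchange? (choose σ14532 σ15432) (transpose (# 1) (# 2))))

13452≡15432 : σ13452 ≡fs σ15432
13452≡15432 = exchange⇒≡fs σ13452 σ15432
  (from-yes (exchange? (choose σ13452 σ15432) (transpose (# 1) (# 3))))

12453≡12543 : σ12453 ≡fs σ12543
12453≡12543 = exchange⇒≡fs σ12453 σ12543
  (from-yes (exchange? (choose σ12453 σ12543) (transpose (# 2) (# 3))))

24153≡25143 : σ24153 ≡fs σ25143
24153≡25143 = exchange⇒≡fs σ24153 σ25143
  (from-yes (exchange? (choose σ24153 σ25143) (transpose (# 1) (# 3))))

corollary3p7 : ((σ13452 ≡fs σ13542) × (σ13542 ≡fs σ14352) × (σ14352 ≡fs σ14532) ×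
    (σ14532 ≡fs σ15342) × (σ15342 ≡fs σ15432)) ×
    (σ12453 ≡fs σ12543) ×
    (σ24153 ≡fs σ25143)
corollary3p7 =
  -- The five transposition steps among these six patterns form a spanning tree; each link of the
  -- chain follows a path in it.
  ( 13452≡13542
  , ≡fs-trans σ13542 σ13452 σ14352 (≡fs-sym σ13452 σ13542 13452≡13542) 13452≡14352
  , 14352≡14532
  , ≡fs-trans σ14532 σ14352 σ15342 (≡fs-sym σ14352 σ14532 14352≡14532) 14352≡15342
  , ≡fs-trans σ15342 σ14352 σ15432 (≡fs-sym σ14352 σ15342 14352≡15342) 14352≡15432 ) ,
  12453≡12543 ,
  24153≡25143
  where
  14352≡15432 : σ14352 ≡fs σ15432
  14352≡15432 = ≡fs-trans σ14352 σ13452 σ15432 (≡fs-sym σ13452 σ14352 13452≡14352) 13452≡15432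

  14352≡14532 : σ14352 ≡fs σ14532
  14352≡14532 = ≡fs-trans σ14352 σ15432 σ14532 14352≡15432 (≡fs-sym σ14532 σ15432 14532≡15432)
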